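{- (i) For every integer $k \geq 2$ there exists a connected graph $G$ with minimum degree $2$ and $\gamma_p(G) = k$ such that, writing $n$ for the order of $G$, $rad_p(G) = n - k - 2k + 1$. (ii) For every integer $\delta \geq 3$ there exists a connected graph $G$ with minimum degree $\delta$ and $\gamma_p(G) = 2$ such that, writing $n$ for the order of $G$, $rad_p(G) = n - \delta - 2$.
   Context: All graphs are finite, simple, undirected and non-empty. For a graph $G$ and $S \subseteq V(G)$, define $P^1_G(S) = N[S]$ (the closed neighbourhood of $S$), and for $i \geq 1$ let $V^i = \{v \in P^i_G(S) : |N[v] \setminus P^i_G(S)| \leq 1\}$ and $P^{i+1}_G(S) = P^i_G(S) \cup N[V^i]$. The set $S$ is a power dominating set (PDS) of $G$ if $P^i_G(S) = V(G)$ for some $i \ge 1$. The power domination number $\gamma_p(G)$ is the minimum cardinality of a PDS of $G$. For a PDS $S$, $rad_p(G,S) = \min\{i \geq 1 : P^i_G(S) = V(G)\}$. The propagation radius of $G$ is $rad_p(G) = \min\{rad_p(G,S) : S \text{ is a PDS of } G \text{ with } |S| = \gamma_p(G)\}$. -}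

module Defs where

open import Data.Fin.Base using (Fin)
open import Data.Fin.Properties using (any?)
open import Data.Fin.Subset using (Subset; _∈_; ⊤; ⁅_⁆; _∪_; _─_; ∣_∣)
open import Data.Fin.Subset.Properties using (_∈?_)
open import Data.Nat.Base using (ℕ; zero; suc; _≤_; NonZero)
open import Data.Nat.Properties using (_≤?_)
open import Data.Product.Base using (_×_; ∃-syntax)
open import Data.Vec.Base using (tabulate)
open import Function.Base using (_∘_)
open import Level using (0ℓ)
open import Relation.Binary.Construct.Closure.ReflexiveTransitive using (Star)
open import Relation.Binary.Core using (Rel)
open import Relation.Binary.Definitions using (Symmetric; Irreflexive) renaming (Decidable to Decidable₂)
open import Relation.Binary.PropositionalEquality.Core using (_≡_)
open import Relation.Nullary.Decidable using (does; _×-dec_)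
open import Relation.Unary using (Pred; Decidable)

record Graph : Set₁ where
  field
    order     : ℕ
    nonEmpty  : NonZero order
    Adj       : Rel (Fin order) 0ℓ
    adj?      : Decidable₂ Adj
    symmetric : Symmetric Adj
    loopless  : Irreflexive _≡_ Adj

-- Minima of sets of naturals are given relationally: every set to which
-- IsMinimum is applied below is nonempty (for IsRadiusOf,
-- when S is a power dominating set) and decidable, and minima are unique, so
-- "IsMinimum Q m" says exactly "min Q = m".
IsMinimum : Pred ℕ 0ℓ → ℕ → Set
IsMinimum Q m = Q m × (∀ m′ → Q m′ → m ≤ m′)

-- { x | P x } as a Subset.
comprehension : ∀ {n} {P : Pred (Fin n) 0ℓ} → Decidable P → Subset n
comprehension P? = tabulate (does ∘ P?)

module _ (G : Graph) where
  open Graph G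

  Connected : Set
  Connected = ∀ u v → Star Adj u v

  neighbours : Fin order → Subset order
  neighbours v = comprehension (adj? v)

  degree : Fin order → ℕ
  degree v = ∣ neighbours v ∣

  IsMinimumDegree : ℕ → Set
  IsMinimumDegree = IsMinimum (λ d → ∃[ v ] degree v ≡ d)

  N[_] : Fin order → Subset order
  N[ v ] = ⁅ v ⁆ ∪ neighbours v

  -- The closed neighbourhood of a set: the union of N[ v ] over v ∈ S.
  N⟦_⟧ : Subset order → Subset order
  N⟦ S ⟧ = comprehension (λ w → any? (λ v → (v ∈? S) ×-dec (w ∈? N[ v ])))

  -- The vertices that may propagate when X is the set monitored so far.
  propagating : Subset order → Subset order
  propagating X = comprehension (λ v → (v ∈? X) ×-dec (∣ N[ v ] ─ X ∣ ≤? 1))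

  -- P S i is the set Pⁱ(S), defined mathematically only for i ≥ 1. The value at
  -- zero is a filler: the definitions below only consider i ≥ 1.
  P : Subset order → ℕ → Subset order
  P S zero          = S
  P S (suc zero)    = N⟦ S ⟧
  P S (suc (suc i)) = P S (suc i) ∪ N⟦ propagating (P S (suc i)) ⟧

  IsPDS : Subset order → Set
  IsPDS S = ∃[ i ] (1 ≤ i × P S i ≡ ⊤)

  -- γₚ(G) = k
  IsPowerDominationNumber : ℕ → Set
  IsPowerDominationNumber = IsMinimum (λ c → ∃[ S ] (IsPDS S × ∣ S ∣ ≡ c))

  -- radₚ(G, S) = r, for a power dominating set S
  IsRadiusOf : Subset order → ℕ → Set
  IsRadiusOf S = IsMinimum (λ i → 1 ≤ i × P S i ≡ ⊤)

  -- radₚ(G) = r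
  IsPropagationRadius : ℕ → Set
  IsPropagationRadius = IsMinimum
    (λ r → ∃[ S ] (IsPDS S × IsPowerDominationNumber ∣ S ∣ × IsRadiusOf S r))

{-# OPTIONS --safe #-}
-- Both parts are realised by graphs of propagation radius 1, in which some
-- minimum power dominating set is already a dominating set. The lower bounds on
-- γₚ come from twins a, b (vertices with the same neighbours outside {a, b}): a
-- set dominating neither of them never monitors them, because a neighbour of
-- one is a neighbour of both and so cannot propagate.
--
-- (i) Take k disjoint triangles and make one vertex of each (its hub) adjacent
-- to all other hubs, so n = 3k. The two remaining vertices of a triangle are
-- twins, so every triangle meets every power dominating set.
--
-- (ii) Take n = δ + 3 and let the complement of G be a disjoint union of at least
-- two cycles of length 3 or 4. The two non-neighbours of any vertex are twins,
-- so no single vertex suffices, while two vertices from different cycles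
-- dominate G.
module Submission where

open import Defs
open import Data.Bool.Base using (true; false)
open import Data.Fin.Base using (Fin; zero; suc; combine; remQuot)
open import Data.Fin.Patterns using (0F; 1F; 2F)
open import Data.Fin.Properties
  using (_≟_; any?; all?; +↔⊎; remQuot-combine; combine-remQuot; combine-injectiveʳ)
open import Data.Fin.Subset using (Subset; _∈_; _∉_; ⊤; ⁅_⁆; _∪_; _─_; ⋃; ∁; ∣_∣)
open import Data.Fin.Subset.Properties
open import Data.Integer.Base using (+_; _+_; _-_; _*_)
import Data.Integer.Properties as ℤ
open import Data.Integer.Tactic.RingSolver using (solve-∀)
open import Data.List.Base as List using (List; []; _∷_; length)
import Data.List.Membership.Propositional as List∈
open import Data.List.Membership.Propositional.Properties using (∈-tabulate⁺)
open import Data.List.Properties using (length-tabulate)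
open import Data.List.Relation.Unary.All as All using (All; []; _∷_)
import Data.List.Relation.Unary.All.Properties as All
open import Data.List.Relation.Unary.Any using (here; there)
open import Data.List.Relation.Unary.Unique.Propositional using (Unique; []; _∷_)
import Data.List.Relation.Unary.Unique.Propositional.Properties as Unique
open import Data.Nat.Base as ℕ using (ℕ; zero; suc; _≤_; z≤n; s≤s)
import Data.Nat.Properties as ℕ
open import Data.Product.Base using (_×_; _,_; ∃-syntax; ∃₂; proj₁; proj₂; uncurry)
open import Data.Sum.Base as Sum using (_⊎_; inj₁; inj₂; [_,_]′)
open import Data.Sum.Properties using (inj₁-injective; inj₂-injective)
open import Data.Sum.Relation.Binary.Pointwise
  using (Pointwise; inj₁; inj₂; ⊎-symmetric; ⊎-decidable)
open import Data.Vec.Base using ([]; _∷_)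
open import Data.Vec.Properties using ([]=⇒lookup; lookup⇒[]=; lookup∘tabulate)
open import Function.Base using (_∘_; _on_)
open import Function.Bundles using (_↔_; Inverse)
open import Level using (0ℓ)
open import Relation.Binary.Construct.Closure.ReflexiveTransitive using (Star; ε; _◅_; _◅◅_; reverse)
open import Relation.Binary.Core using (Rel)
open import Relation.Binary.Definitions using (Symmetric) renaming (Decidable to Decidable₂)
open import Relation.Binary.PropositionalEquality
  using (_≡_; _≢_; refl; sym; trans; cong; subst; subst₂)
open import Relation.Nullary using (¬_; Dec; yes; no; contradiction)
open import Relation.Nullary.Decidable
  using (dec-true; from-yes; ¬?; _×-dec_; _⊎-dec_; _→-dec_)
open import Relation.Unary using (Pred; Decidable)

-- Finite subsets

module _ {n : ℕ} {Q : Pred (Fin n) 0ℓ} (Q? : Decidable Q) where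

  ∈-comprehension⁺ : ∀ {x} → Q x → x ∈ comprehension Q?
  ∈-comprehension⁺ {x} q =
    lookup⇒[]= x _ (trans (lookup∘tabulate _ x) (dec-true (Q? x) q))

  ∈-comprehension⁻ : ∀ {x} → x ∈ comprehension Q? → Q x
  ∈-comprehension⁻ {x} x∈ with Q? x | trans (sym (lookup∘tabulate _ x)) ([]=⇒lookup x∈)
  ... | yes q | _  = q
  ... | no _  | ()

∣p∪q∣≤∣p∣+∣q∣ : ∀ {n} (p q : Subset n) → ∣ p ∪ q ∣ ≤ ∣ p ∣ ℕ.+ ∣ q ∣
∣p∪q∣≤∣p∣+∣q∣ []          []          = z≤n
∣p∪q∣≤∣p∣+∣q∣ (true  ∷ p) (true  ∷ q) =
  s≤s (ℕ.≤-trans (∣p∪q∣≤∣p∣+∣q∣ p q) (ℕ.+-monoʳ-≤ ∣ p ∣ (ℕ.n≤1+n ∣ q ∣)))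
∣p∪q∣≤∣p∣+∣q∣ (true  ∷ p) (false ∷ q) = s≤s (∣p∪q∣≤∣p∣+∣q∣ p q)
∣p∪q∣≤∣p∣+∣q∣ (false ∷ p) (true  ∷ q) =
  subst (suc ∣ p ∪ q ∣ ≤_) (sym (ℕ.+-suc ∣ p ∣ ∣ q ∣)) (s≤s (∣p∪q∣≤∣p∣+∣q∣ p q))
∣p∪q∣≤∣p∣+∣q∣ (false ∷ p) (false ∷ q) = ∣p∪q∣≤∣p∣+∣q∣ p q

fromList : ∀ {n} → List (Fin n) → Subset n
fromList = ⋃ ∘ List.map ⁅_⁆

∈-fromList : ∀ {n} {x : Fin n} {xs} → x List∈.∈ xs → x ∈ fromList xs
∈-fromList (here refl) = x∈p∪q⁺ (inj₁ (x∈⁅x⁆ _))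
∈-fromList (there x∈)  = x∈p∪q⁺ (inj₂ (∈-fromList x∈))

∣fromList∣≤length : ∀ {n} (xs : List (Fin n)) → ∣ fromList xs ∣ ≤ length xs
∣fromList∣≤length {n} []       = ℕ.≤-reflexive (∣⊥∣≡0 n)
∣fromList∣≤length     (x ∷ xs) = ℕ.≤-trans (∣p∪q∣≤∣p∣+∣q∣ ⁅ x ⁆ (fromList xs))
  (subst (λ c → c ℕ.+ _ ≤ _) (sym (∣⁅x⁆∣≡1 x)) (s≤s (∣fromList∣≤length xs)))

⊆list⇒∣p∣≤length : ∀ {n} {p : Subset n} (xs : List (Fin n)) →
                   (∀ {x} → x ∈ p → x List∈.∈ xs) → ∣ p ∣ ≤ length xs
⊆list⇒∣p∣≤length xs p⊆xs =
  ℕ.≤-trans (p⊆q⇒∣p∣≤∣q∣ (∈-fromList ∘ p⊆xs)) (∣fromList∣≤length xs)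

-- Induction deletes the head from `p`: the tail avoids the head, so it stays inside the smaller
-- set, and the deletion lowers the cardinality.
unique⇒length≤∣p∣ : ∀ {n} {p : Subset n} {xs : List (Fin n)} →
                    Unique xs → All (_∈ p) xs → length xs ≤ ∣ p ∣
unique⇒length≤∣p∣ []            []          = z≤n
unique⇒length≤∣p∣ (x≢xs ∷ uniq) (x∈p ∷ xs∈p) = ℕ.≤-trans
  (s≤s (unique⇒length≤∣p∣ uniq
    (All.map (λ (x≢y , y∈p) → x∈p∧x≢y⇒x∈p-y y∈p (x≢y ∘ sym)) (All.zip (x≢xs , xs∈p)))))
  (x∈p⇒∣p-x∣<∣p∣ x∈p)

2≤∣p∣ : ∀ {n} {p : Subset n} {x y} → x ≢ y → x ∈ p → y ∈ p → 2 ≤ ∣ p ∣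
2≤∣p∣ x≢y x∈p y∈p = unique⇒length≤∣p∣ ((x≢y ∷ []) ∷ [] ∷ []) (x∈p ∷ y∈p ∷ [])

-- Domination and twins

module _ (G : Graph) where
  open Graph G

  Dominates : Rel (Fin order) 0ℓ
  Dominates v w = w ≡ v ⊎ Adj v w

  ∈N[]⁺ : ∀ {v w} → Dominates v w → w ∈ N[_] G v
  ∈N[]⁺ (inj₁ refl) = x∈p∪q⁺ (inj₁ (x∈⁅x⁆ _))
  ∈N[]⁺ (inj₂ v~w)  = x∈p∪q⁺ (inj₂ (∈-comprehension⁺ (adj? _) v~w))

  ∈N[]⁻ : ∀ {v w} → w ∈ N[_] G v → Dominates v w
  ∈N[]⁻ {v} w∈ = Sum.map (x∈⁅y⁆⇒x≡y v) (∈-comprehension⁻ (adj? v)) (x∈p∪q⁻ ⁅ v ⁆ _ w∈)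

  dominatedBy? : ∀ S → Decidable (λ w → ∃[ v ] (v ∈ S × w ∈ N[_] G v))
  dominatedBy? S w = any? (λ v → (v ∈? S) ×-dec (w ∈? N[_] G v))

  propagates? : ∀ X → Decidable (λ v → v ∈ X × ∣ N[_] G v ─ X ∣ ≤ 1)
  propagates? X v = (v ∈? X) ×-dec (∣ N[_] G v ─ X ∣ ℕ.≤? 1)

  ∈N⟦⟧⁻ : ∀ {S w} → w ∈ N⟦_⟧ G S → ∃[ v ] (v ∈ S × Dominates v w)
  ∈N⟦⟧⁻ {S} w∈ with v , v∈S , w∈N ← ∈-comprehension⁻ (dominatedBy? S) w∈ =
    v , v∈S , ∈N[]⁻ w∈N

  ∈N⟦⟧⁺ : ∀ {S v w} → v ∈ S → Dominates v w → w ∈ N⟦_⟧ G S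
  ∈N⟦⟧⁺ {S} v∈S v▹w = ∈-comprehension⁺ (dominatedBy? S) (_ , v∈S , ∈N[]⁺ v▹w)

  -- Adjacency between `a` and `b` is left open because both cases occur: the leaves of a triangle
  -- are adjacent, and in the complement twins from a 4-cycle are adjacent while twins from a
  -- 3-cycle are not.
  record Twins (a b : Fin order) : Set where
    constructor twins
    field
      distinct : a ≢ b
      forth    : ∀ {u} → u ≢ b → Adj u a → Adj u b
      back     : ∀ {u} → u ≢ a → Adj u b → Adj u a

  Twins-sym : ∀ {a b} → Twins a b → Twins b a
  Twins-sym (twins a≢b f g) = twins (a≢b ∘ sym) g f

  twin-not-propagated : ∀ {X a b} → Twins a b → a ∉ X → b ∉ X → a ∉ N⟦_⟧ G (propagating G X)
  twin-not-propagated {X} {a} {b} t a∉X b∉X a∈ with v , v∈ , v▹a ← ∈N⟦⟧⁻ a∈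
    with v∈X , ≤1 ← ∈-comprehension⁻ (propagates? X) v∈
       | v▹a
  ... | inj₁ refl = a∉X v∈X
  ... | inj₂ v~a  = ℕ.<⇒≱ (2≤∣p∣ (Twins.distinct t) (missing v~a a∉X) (missing v~b b∉X)) ≤1
    where
    v~b : Adj v b
    v~b = Twins.forth t (λ { refl → b∉X v∈X }) v~a

    missing : ∀ {w} → Adj v w → w ∉ X → w ∈ N[_] G v ─ X
    missing v~w = x∈p∧x∉q⇒x∈p─q (∈N[]⁺ (inj₂ v~w))

  -- Both halves go through the induction together, since each twin is safe only while the other is
  -- unmonitored. The index `suc i` skips the filler value of `P` at zero.
  twins-never-monitored : ∀ {S a b} → Twins a b → a ∉ N⟦_⟧ G S → b ∉ N⟦_⟧ G S →
                          ∀ i → a ∉ P G S (suc i) × b ∉ P G S (suc i)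
  twins-never-monitored t a∉ b∉ zero    = a∉ , b∉
  twins-never-monitored {S} {a} {b} t a∉ b∉ (suc i)
    with a∉P , b∉P ← twins-never-monitored t a∉ b∉ i
    = [ a∉P , twin-not-propagated t a∉P b∉P ]′ ∘ x∈p∪q⁻ _ _
    , [ b∉P , twin-not-propagated (Twins-sym t) b∉P a∉P ]′ ∘ x∈p∪q⁻ _ _

  PDS-dominates-twin : ∀ {S a b} → IsPDS G S → Twins a b →
                       ∃[ v ] (v ∈ S × (Dominates v a ⊎ Dominates v b))
  PDS-dominates-twin {S} {a} {b} (suc i , _ , P≡⊤) t with a ∈? N⟦_⟧ G S | b ∈? N⟦_⟧ G S
  ... | yes a∈ | _      with v , v∈S , v▹a ← ∈N⟦⟧⁻ a∈ = v , v∈S , inj₁ v▹a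
  ... | no _   | yes b∈ with v , v∈S , v▹b ← ∈N⟦⟧⁻ b∈ = v , v∈S , inj₂ v▹b
  ... | no a∉  | no b∉  =
    contradiction (subst (a ∈_) (sym P≡⊤) ∈⊤) (proj₁ (twins-never-monitored t a∉ b∉ i))

  -- A certificate shared by both constructions: domination yields radius 1, mutual adjacency yields
  -- connectedness.
  record DominatingClique (k : ℕ) : Set where
    field
      vertex   : Fin k → Fin order
      adjacent : ∀ {i j} → i ≢ j → Adj (vertex i) (vertex j)
      dominate : ∀ w → ∃[ i ] Dominates (vertex i) w

  module _ {k : ℕ} (clique : DominatingClique k) where
    open DominatingClique clique

    dominatingClique⇒Connected : Connected G
    dominatingClique⇒Connected u v with i , i▹u ← dominate u | j , j▹v ← dominate v =
      reverse symmetric (walk i▹u) ◅◅ between i j ◅◅ walk j▹v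
      where
      walk : ∀ {x y} → Dominates x y → Star Adj x y
      walk (inj₁ refl) = ε
      walk (inj₂ x~y)  = x~y ◅ ε

      between : ∀ i j → Star Adj (vertex i) (vertex j)
      between i j with i ≟ j
      ... | yes refl = ε
      ... | no i≢j   = adjacent i≢j ◅ ε

    cliqueSet : Subset order
    cliqueSet = fromList (List.tabulate vertex)

    cliqueSet-dominates : P G cliqueSet 1 ≡ ⊤
    cliqueSet-dominates = ⊆-antisym ⊆⊤ λ {w} _ → let i , i▹w = dominate w in
      ∈N⟦⟧⁺ (∈-fromList (∈-tabulate⁺ i)) i▹w

    cliqueSet-PDS : IsPDS G cliqueSet
    cliqueSet-PDS = 1 , s≤s z≤n , cliqueSet-dominates

    module _ (lowerBound : ∀ {S} → IsPDS G S → k ≤ ∣ S ∣) where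

      -- Listing `k` vertices bounds the size from above; the lower bound for power dominating sets,
      -- applied to the clique itself, bounds it from below.
      ∣cliqueSet∣≡k : ∣ cliqueSet ∣ ≡ k
      ∣cliqueSet∣≡k = ℕ.≤-antisym
        (subst (∣ cliqueSet ∣ ≤_) (length-tabulate vertex) (∣fromList∣≤length (List.tabulate vertex)))
        (lowerBound cliqueSet-PDS)

      dominatingClique⇒γₚ : IsPowerDominationNumber G k
      dominatingClique⇒γₚ =
        (cliqueSet , cliqueSet-PDS , ∣cliqueSet∣≡k) , λ { _ (_ , pds , refl) → lowerBound pds }

      dominatingClique⇒radₚ≡1 : IsPropagationRadius G 1
      dominatingClique⇒radₚ≡1 =
        ( cliqueSet , cliqueSet-PDS
        , subst (IsPowerDominationNumber G) (sym ∣cliqueSet∣≡k) dominatingClique⇒γₚ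
        , (s≤s z≤n , cliqueSet-dominates) , λ _ → proj₁ )
        -- Stages are counted from 1, so no radius is smaller.
        , λ { _ (_ , _ , _ , (1≤r , _) , _) → 1≤r }

-- Triangles with pairwise adjacent hubs

module _ (k-1 : ℕ) where

  private
    k = suc k-1

  -- The second coordinate `0F` marks the hub of a triangle; `1F` and `2F` are its leaves.
  data Linked : Rel (Fin k × Fin 3) 0ℓ where
    triangle : ∀ {i a b} → a ≢ b → Linked (i , a) (i , b)
    hubs     : ∀ {i j} → i ≢ j → Linked (i , 0F) (j , 0F)

  linked? : Decidable₂ Linked
  linked? (i , a) (j , b) with i ≟ j | a ≟ b | a ≟ 0F | b ≟ 0F
  ... | yes refl | no a≢b   | _        | _        = yes (triangle a≢b)
  ... | yes refl | yes a≡b  | _        | _        =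
    no λ { (triangle a≢b) → a≢b a≡b ; (hubs i≢i) → i≢i refl }
  ... | no i≢j   | _        | yes refl | yes refl = yes (hubs i≢j)
  ... | no i≢j   | _        | no a≢0   | _        =
    no λ { (triangle _) → i≢j refl ; (hubs _) → a≢0 refl }
  ... | no i≢j   | _        | _        | no b≢0   =
    no λ { (triangle _) → i≢j refl ; (hubs _) → b≢0 refl }

  linked-sym : Symmetric Linked
  linked-sym (triangle a≢b) = triangle (a≢b ∘ sym)
  linked-sym (hubs i≢j)     = hubs (i≢j ∘ sym)

  linked-irrefl : ∀ {x} → ¬ Linked x x
  linked-irrefl (triangle a≢a) = a≢a refl
  linked-irrefl (hubs i≢i)     = i≢i refl

  triangles : Graph
  triangles = record
    { order     = k ℕ.* 3
    -- The order reduces to a successor because `k` is `suc k-1`.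
    ; nonEmpty  = _
    ; Adj       = Linked on remQuot 3
    ; adj?      = λ u v → linked? (remQuot 3 u) (remQuot 3 v)
    ; symmetric = linked-sym
    ; loopless  = λ { refl → linked-irrefl }
    }

  open Graph triangles

  at : Fin k → Fin 3 → Fin order
  at = combine

  coordinates : Fin order → Fin k × Fin 3
  coordinates = remQuot 3

  block : Fin order → Fin k
  block = proj₁ ∘ coordinates

  coordinates-at : ∀ i a → coordinates (at i a) ≡ (i , a)
  coordinates-at = remQuot-combine

  at-≢ : ∀ i {a b} → a ≢ b → at i a ≢ at i b
  at-≢ i {a} {b} a≢b = a≢b ∘ combine-injectiveʳ i a i b

  -- An induction principle: claims about vertices are checked in coordinates, where `Linked` can be
  -- matched on.
  at-surj : (Q : Pred (Fin order) 0ℓ) → (∀ i a → Q (at i a)) → ∀ v → Q v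
  at-surj Q q v = subst Q (combine-remQuot {k} 3 v) (uncurry q (coordinates v))

  adj⁺ : ∀ i a j b → Linked (i , a) (j , b) → Adj (at i a) (at j b)
  adj⁺ i a j b = subst₂ Linked (sym (coordinates-at i a)) (sym (coordinates-at j b))

  adj⁻ : ∀ i a j b → Adj (at i a) (at j b) → Linked (i , a) (j , b)
  adj⁻ i a j b = subst₂ Linked (coordinates-at i a) (coordinates-at j b)

  -- Edges between triangles join hubs only, so a neighbour of a leaf lies in the same triangle,
  -- where all distinct vertices are adjacent.
  leaf-transfer : ∀ i {a b} → a ≢ 0F → ∀ {u} → u ≢ at i b → Adj u (at i a) → Adj u (at i b)
  leaf-transfer i {a} {b} a≢0 {u} = at-surj
    (λ u → u ≢ at i b → Adj u (at i a) → Adj u (at i b))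
    (λ j c u≢ → adj⁺ j c i b ∘ transfer u≢ ∘ adj⁻ j c i a) u
    where
    transfer : ∀ {j c} → at j c ≢ at i b → Linked (j , c) (i , a) → Linked (j , c) (i , b)
    transfer u≢ (triangle _) = triangle λ { refl → u≢ refl }
    transfer u≢ (hubs _)     = contradiction refl a≢0

  leaf-twins : ∀ i → Twins triangles (at i 1F) (at i 2F)
  leaf-twins i = twins (at-≢ i λ ()) (leaf-transfer i λ ()) (leaf-transfer i λ ())

  leaf-dominator : ∀ i {a v} → a ≢ 0F → Dominates triangles v (at i a) → block v ≡ i
  leaf-dominator i {a} a≢0 (inj₁ refl) = cong proj₁ (coordinates-at i a)
  leaf-dominator i {a} {v} a≢0 (inj₂ v~) =
    sameBlock (subst (Linked (coordinates v)) (coordinates-at i a) v~)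
    where
    sameBlock : ∀ {x} → Linked x (i , a) → proj₁ x ≡ i
    sameBlock (triangle _) = refl
    sameBlock (hubs _)     = contradiction refl a≢0

  -- The leaf twins of each triangle force a member of `S` into that triangle. `block` recovers the
  -- triangle from this representative, so the `k` representatives are distinct.
  triangles-lowerBound : ∀ {S} → IsPDS triangles S → k ≤ ∣ S ∣
  triangles-lowerBound {S} pds = subst (_≤ ∣ S ∣) (length-tabulate representative)
    (unique⇒length≤∣p∣
      (Unique.tabulate⁺ {f = representative} λ {i} {j} eq →
        trans (sym (inBlock i)) (trans (cong block eq) (inBlock j)))
      (All.tabulate⁺ λ i → proj₁ (proj₂ (dominator i))))
    where
    dominator : ∀ i → ∃[ v ] (v ∈ S ×
                  (Dominates triangles v (at i 1F) ⊎ Dominates triangles v (at i 2F)))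
    dominator i = PDS-dominates-twin triangles pds (leaf-twins i)

    representative : Fin k → Fin order
    representative = proj₁ ∘ dominator

    inBlock : ∀ i → block (representative i) ≡ i
    inBlock i = [ leaf-dominator i (λ ()) , leaf-dominator i (λ ()) ]′ (proj₂ (proj₂ (dominator i)))

  hubClique : DominatingClique triangles k
  hubClique = record
    { vertex   = λ i → at i 0F
    ; adjacent = λ {i} {j} i≢j → adj⁺ i 0F j 0F (hubs i≢j)
    ; dominate = at-surj (λ w → ∃[ j ] Dominates triangles (at j 0F) w) dominated
    }
    where
    dominated : ∀ i a → ∃[ j ] Dominates triangles (at j 0F) (at i a)
    dominated i zero    = i , inj₁ refl
    dominated i (suc a) = i , inj₂ (adj⁺ i 0F i (suc a) (triangle λ ()))

  triangles-degree≥2 : ∀ v → 2 ≤ degree triangles v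
  triangles-degree≥2 = at-surj (λ v → 2 ≤ degree triangles v) λ
    { i 0F → bound i 0F 1F 2F (λ ()) (λ ()) (λ ())
    ; i 1F → bound i 1F 0F 2F (λ ()) (λ ()) (λ ())
    ; i 2F → bound i 2F 0F 1F (λ ()) (λ ()) (λ ())
    }
    where
    bound : ∀ i a b c → a ≢ b → a ≢ c → b ≢ c → 2 ≤ degree triangles (at i a)
    bound i a b c a≢b a≢c b≢c = 2≤∣p∣ (at-≢ i b≢c)
      (∈-comprehension⁺ (adj? (at i a)) (adj⁺ i a i b (triangle a≢b)))
      (∈-comprehension⁺ (adj? (at i a)) (adj⁺ i a i c (triangle a≢c)))

  leaf-degree≤2 : ∀ i → degree triangles (at i 1F) ≤ 2
  leaf-degree≤2 i = ⊆list⇒∣p∣≤length others λ {v} →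
    at-surj (λ v → v ∈ neighbours triangles (at i 1F) → v List∈.∈ others)
      (λ j b → listed ∘ adj⁻ i 1F j b ∘ ∈-comprehension⁻ (adj? (at i 1F))) v
    where
    others : List (Fin order)
    others = at i 0F ∷ at i 2F ∷ []

    listed : ∀ {j b} → Linked (i , 1F) (j , b) → at j b List∈.∈ others
    listed {b = 0F} (triangle _)   = here refl
    listed {b = 1F} (triangle 1≢1) = contradiction refl 1≢1
    listed {b = 2F} (triangle _)   = there (here refl)

  triangles-minimumDegree : IsMinimumDegree triangles 2
  triangles-minimumDegree =
    (at 0F 1F , ℕ.≤-antisym (leaf-degree≤2 0F) (triangles-degree≥2 (at 0F 1F)))
    , λ { _ (v , refl) → triangles-degree≥2 v }

-- Two-regular complements made of cycles of length 3 and 4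

-- On a cycle this forces length 3 or 4: either `a` and `b` are adjacent, or the other neighbour of
-- `a` must also be the other neighbour of `b`.
record TwinPair {A : Set} (H : Rel A 0ℓ) (x a b : A) : Set where
  constructor twinPair
  field
    distinct : a ≢ b
    left     : H x a
    right    : H x b
    only     : ∀ y → H x y → y ≡ a ⊎ y ≡ b
    forth    : ∀ u → u ≢ b → H u a → H u b
    back     : ∀ u → u ≢ a → H u b → H u a

-- H is the adjacency of the complement of the graph; the finite such relations
-- are exactly the disjoint unions of 3-cycles and 4-cycles.
record TwinCycles (A : Set) : Set₁ where
  field
    H        : Rel A 0ℓ
    H?       : Decidable₂ H
    H-sym    : Symmetric H
    H-irrefl : ∀ x → ¬ H x x
    pair     : ∀ x → ∃₂ (TwinPair H x)

  -- On a 3-cycle or 4-cycle any two closed neighbourhoods meet, so disjointness means that `u` and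
  -- `v` lie on different cycles.
  Apart : Rel A 0ℓ
  Apart u v = ∀ w → w ≡ u ⊎ H u w → ¬ (w ≡ v ⊎ H v w)

open TwinCycles using (Apart)

-- Decidability lets exhaustive search supply the pairs of the two small cycles.
twinPair? : ∀ {n} {H : Rel (Fin n) 0ℓ} → Decidable₂ H → ∀ x a b → Dec (TwinPair H x a b)
twinPair? _~?_ x a b with
  ¬? (a ≟ b) ×-dec (x ~? a) ×-dec (x ~? b)
    ×-dec all? (λ y → (x ~? y) →-dec ((y ≟ a) ⊎-dec (y ≟ b)))
    ×-dec all? (λ u → ¬? (u ≟ b) →-dec ((u ~? a) →-dec (u ~? b)))
    ×-dec all? (λ u → ¬? (u ≟ a) →-dec ((u ~? b) →-dec (u ~? a)))
... | yes (d , l , r , o , f , g) = yes (twinPair d l r o f g)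
... | no ¬p = no λ (twinPair d l r o f g) → ¬p (d , l , r , o , f , g)

C₃ : TwinCycles (Fin 3)
C₃ = record
  { H        = _≢_
  ; H?       = ≢?
  ; H-sym    = λ x≢y → x≢y ∘ sym
  ; H-irrefl = λ _ x≢x → x≢x refl
  ; pair     = from-yes (all? λ x → any? λ a → any? λ b → twinPair? ≢? x a b)
  }
  where
  ≢? : Decidable₂ {A = Fin 3} _≢_
  ≢? x y = ¬? (x ≟ y)

-- The 4-cycle as K₂,₂.
C₄ : TwinCycles (Fin 4)
C₄ = record
  { H        = _≢_ on side
  ; H?       = ≢?
  ; H-sym    = λ x≢y → x≢y ∘ sym
  ; H-irrefl = λ _ x≢x → x≢x refl
  ; pair     = from-yes (all? λ x → any? λ a → any? λ b → twinPair? ≢? x a b)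
  }
  where
  side : Fin 4 → Fin 2
  side = proj₂ ∘ remQuot {2} 2

  ≢? : Decidable₂ (_≢_ on side)
  ≢? x y = ¬? (side x ≟ side y)

-- Disjoint unions and relabelling of twin cycles

module _ {A B : Set} where

  inj₁-pair : {H : Rel A 0ℓ} {K : Rel B 0ℓ} → ∀ {x a b} →
              TwinPair H x a b → TwinPair (Pointwise H K) (inj₁ x) (inj₁ a) (inj₁ b)
  inj₁-pair (twinPair d l r o f g) = twinPair (d ∘ inj₁-injective) (inj₁ l) (inj₁ r)
    (λ { (inj₁ y) (inj₁ p) → Sum.map (cong inj₁) (cong inj₁) (o y p) })
    (λ { (inj₁ u) u≢ (inj₁ p) → inj₁ (f u (u≢ ∘ cong inj₁) p) })
    (λ { (inj₁ u) u≢ (inj₁ p) → inj₁ (g u (u≢ ∘ cong inj₁) p) })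

  inj₂-pair : {H : Rel A 0ℓ} {K : Rel B 0ℓ} → ∀ {x a b} →
              TwinPair K x a b → TwinPair (Pointwise H K) (inj₂ x) (inj₂ a) (inj₂ b)
  inj₂-pair (twinPair d l r o f g) = twinPair (d ∘ inj₂-injective) (inj₂ l) (inj₂ r)
    (λ { (inj₂ y) (inj₂ p) → Sum.map (cong inj₂) (cong inj₂) (o y p) })
    (λ { (inj₂ u) u≢ (inj₂ p) → inj₂ (f u (u≢ ∘ cong inj₂) p) })
    (λ { (inj₂ u) u≢ (inj₂ p) → inj₂ (g u (u≢ ∘ cong inj₂) p) })

  disjointUnion : TwinCycles A → TwinCycles B → TwinCycles (A ⊎ B)
  disjointUnion C D = record
    { H        = Pointwise C.H D.H
    ; H?       = ⊎-decidable C.H? D.H?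
    ; H-sym    = ⊎-symmetric C.H-sym D.H-sym
    ; H-irrefl = λ { (inj₁ x) (inj₁ p) → C.H-irrefl x p ; (inj₂ x) (inj₂ p) → D.H-irrefl x p }
    ; pair     = λ { (inj₁ x) → let a , b , p = C.pair x in inj₁ a , inj₁ b , inj₁-pair p
                   ; (inj₂ x) → let a , b , p = D.pair x in inj₂ a , inj₂ b , inj₂-pair p }
    }
    where
    module C = TwinCycles C
    module D = TwinCycles D

  disjointUnion-apart : (C : TwinCycles A) (D : TwinCycles B) → ∀ x y →
                        Apart (disjointUnion C D) (inj₁ x) (inj₂ y)
  disjointUnion-apart C D x y _ (inj₁ refl)     (inj₁ ())
  disjointUnion-apart C D x y _ (inj₁ refl)     (inj₂ ())
  disjointUnion-apart C D x y _ (inj₂ (inj₁ _)) (inj₁ ())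
  disjointUnion-apart C D x y _ (inj₂ (inj₁ _)) (inj₂ ())

module _ {A B : Set} (A↔B : A ↔ B) where
  open Inverse A↔B

  transport : TwinCycles B → TwinCycles A
  transport C = record
    { H        = C.H on to
    ; H?       = λ x y → C.H? (to x) (to y)
    ; H-sym    = C.H-sym
    ; H-irrefl = C.H-irrefl ∘ to
    ; pair     = λ x → let a , b , p = C.pair (to x) in
        from a , from b
        , pull (subst₂ (TwinPair C.H (to x)) (sym (strictlyInverseˡ a)) (sym (strictlyInverseˡ b)) p)
    }
    where
    module C = TwinCycles C

    to-injective : ∀ {x y} → to x ≡ to y → x ≡ y
    to-injective {x} {y} eq =
      trans (sym (strictlyInverseʳ x)) (trans (cong from eq) (strictlyInverseʳ y))

    pull : ∀ {x a b} → TwinPair C.H (to x) (to a) (to b) → TwinPair (C.H on to) x a b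
    pull (twinPair d l r o f g) = twinPair (d ∘ cong to) l r
      (λ y → Sum.map to-injective to-injective ∘ o (to y))
      (λ u u≢ → f (to u) (u≢ ∘ to-injective))
      (λ u u≢ → g (to u) (u≢ ∘ to-injective))

  transport-apart : (C : TwinCycles B) → ∀ {u v} → Apart C u v → Apart (transport C) (from u) (from v)
  transport-apart C ap w p q = ap (to w) (push p) (push q)
    where
    open TwinCycles C using (H)

    push : ∀ {u} → w ≡ from u ⊎ H (to (from u)) (to w) → to w ≡ u ⊎ H u (to w)
    push {u} = Sum.map (λ { refl → strictlyInverseˡ u })
                       (subst (λ x → H x (to w)) (strictlyInverseˡ u))

record SplitTwinCycles (n : ℕ) : Set₁ where
  field
    cycles        : TwinCycles (Fin n)
    first second  : Fin n
    apart         : Apart cycles first second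

open SplitTwinCycles using (cycles)

_⊕_ : ∀ {m n} → TwinCycles (Fin (suc m)) → TwinCycles (Fin (suc n)) → SplitTwinCycles (suc m ℕ.+ suc n)
C ⊕ D = record
  { cycles = transport +↔⊎ (disjointUnion C D)
  -- This type also determines `first` and `second`: they are the images of `0F` from the two
  -- summands.
  ; apart  = transport-apart +↔⊎ (disjointUnion C D) (disjointUnion-apart C D 0F 0F)
  }

-- Every integer from 6 on is a sum of at least two terms 3 or 4: the sums 6, 7 and 8 cover the
-- residues modulo 3, and each further 3 adds a triangle.
twinCycles : ∀ m → SplitTwinCycles (6 ℕ.+ m)
twinCycles 0                   = C₃ ⊕ C₃
twinCycles 1                   = C₃ ⊕ C₄
twinCycles 2                   = C₄ ⊕ C₄
twinCycles (suc (suc (suc m))) = C₃ ⊕ cycles (twinCycles m)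

-- The graph whose complement consists of the twin cycles

module _ {n-1 : ℕ} (split : SplitTwinCycles (suc n-1)) where

  open SplitTwinCycles split hiding (cycles)
  open TwinCycles (cycles split) hiding (Apart)

  private
    n = suc n-1

  complement : Graph
  complement = record
    { order     = n
    ; nonEmpty  = _
    ; Adj       = λ x y → x ≢ y × ¬ H x y
    ; adj?      = λ x y → ¬? (x ≟ y) ×-dec ¬? (H? x y)
    ; symmetric = λ (x≢y , ¬xy) → x≢y ∘ sym , ¬xy ∘ H-sym
    ; loopless  = λ x≡y (x≢y , _) → x≢y x≡y
    }

  open Graph complement using (Adj; adj?)

  H⇒≢ : ∀ {x y} → H x y → x ≢ y
  H⇒≢ xy refl = H-irrefl _ xy

  -- Twins survive complementation, with the two directions exchanged by contraposition.
  complement-twins : ∀ {x a b} → TwinPair H x a b → Twins complement a b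
  complement-twins p = twins (TwinPair.distinct p)
    (λ u≢b (u≢a , ¬ua) → u≢b , ¬ua ∘ TwinPair.back p _ u≢a)
    (λ u≢a (u≢b , ¬ub) → u≢a , ¬ub ∘ TwinPair.forth p _ u≢b)

  ¬dominates-H : ∀ {x y} → H x y → ¬ Dominates complement x y
  ¬dominates-H xy (inj₁ refl)      = H-irrefl _ xy
  ¬dominates-H xy (inj₂ (_ , ¬xy)) = ¬xy xy

  -- The pair of the arbitrary vertex `0F` only produces some `v` in `S`. The pair of `v` itself
  -- consists of vertices that `v` does not dominate, so its dominator `w` is a second member.
  complement-lowerBound : ∀ {S} → IsPDS complement S → 2 ≤ ∣ S ∣
  complement-lowerBound pds
    with _ , _ , p₀ ← pair 0F
    with v , v∈S , _ ← PDS-dominates-twin complement pds (complement-twins p₀)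
    with _ , _ , p ← pair v
    with w , w∈S , w▹ ← PDS-dominates-twin complement pds (complement-twins p)
    = 2≤∣p∣ v≢w v∈S w∈S
    where
    v≢w : v ≢ w
    v≢w refl = [ ¬dominates-H (TwinPair.left p) , ¬dominates-H (TwinPair.right p) ]′ w▹

  apartClique : DominatingClique complement 2
  apartClique = record { vertex = vertex ; adjacent = adjacent ; dominate = dominate }
    where
    vertex : Fin 2 → Fin n
    vertex 0F = first
    vertex 1F = second

    first~second : Adj first second
    first~second = (λ eq → apart first (inj₁ refl) (inj₁ eq))
                 , (λ h → apart second (inj₂ h) (inj₁ refl))

    adjacent : ∀ {i j} → i ≢ j → Adj (vertex i) (vertex j)
    adjacent {0F} {0F} 0≢0 = contradiction refl 0≢0
    adjacent {0F} {1F} _   = first~second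
    adjacent {1F} {0F} _   = Graph.symmetric complement first~second
    adjacent {1F} {1F} 1≢1 = contradiction refl 1≢1

    dominate : ∀ w → ∃[ i ] Dominates complement (vertex i) w
    dominate w with H? first w | w ≟ first
    ... | _        | yes w≡first = 0F , inj₁ w≡first
    ... | no ¬h    | no w≢first  = 0F , inj₂ (w≢first ∘ sym , ¬h)
    -- An `H`-neighbour of `first` is, by apartness, neither `second` nor an `H`-neighbour of it.
    ... | yes h    | no _        =
      1F , inj₂ ((λ eq → apart w (inj₂ h) (inj₁ (sym eq))) , λ h′ → apart w (inj₂ h) (inj₂ h′))

  -- It is easier to count what `v` misses: its non-neighbours, itself included, are exactly `v` and
  -- its two `H`-neighbours.
  complement-degree : ∀ v → degree complement v ≡ n ℕ.∸ 3
  complement-degree v with a , b , p ← pair v =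
    trans (sym (ℕ.m∸[m∸n]≡n (∣p∣≤n nbrs)))
      (cong (n ℕ.∸_) (trans (sym (∣∁p∣≡n∸∣p∣ nbrs)) ∣∁nbrs∣≡3))
    where
    open TwinPair p
    nbrs = neighbours complement v

    nonAdjacent : ∀ {w} → ¬ Adj v w → w ∈ ∁ nbrs
    nonAdjacent ¬vw = x∉p⇒x∈∁p (¬vw ∘ ∈-comprehension⁻ (adj? v))

    listed : ∀ {w} → w ∈ ∁ nbrs → w List∈.∈ (v ∷ a ∷ b ∷ [])
    listed {w} w∈ with v ≟ w | H? v w
    ... | yes refl | _     = here refl
    ... | no v≢w   | no ¬h =
      contradiction (∈-comprehension⁺ (adj? v) (v≢w , ¬h)) (x∈∁p⇒x∉p w∈)
    ... | no _     | yes h = there ([ here , there ∘ here ]′ (only w h))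

    ∣∁nbrs∣≡3 : ∣ ∁ nbrs ∣ ≡ 3
    ∣∁nbrs∣≡3 = ℕ.≤-antisym
      (⊆list⇒∣p∣≤length (v ∷ a ∷ b ∷ []) listed)
      (unique⇒length≤∣p∣
        ((H⇒≢ left ∷ H⇒≢ right ∷ []) ∷ (distinct ∷ []) ∷ [] ∷ [])
        ( nonAdjacent (λ (v≢v , _) → v≢v refl)
        ∷ nonAdjacent (λ (_ , ¬h) → ¬h left)
        ∷ nonAdjacent (λ (_ , ¬h) → ¬h right) ∷ []))

  complement-minimumDegree : IsMinimumDegree complement (n ℕ.∸ 3)
  complement-minimumDegree =
    (0F , complement-degree 0F) , λ { _ (v , refl) → ℕ.≤-reflexive (sym (complement-degree v)) }

mainTheorem4 : (∀ (k : ℕ) → 2 ≤ k →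
    ∃[ G ] (Connected G × IsMinimumDegree G 2 × IsPowerDominationNumber G k ×
    ∃[ r ] (IsPropagationRadius G r ×
    + r ≡ + Graph.order G - + k - + 2 * + k + + 1)))
    ×
    (∀ (δ : ℕ) → 3 ≤ δ →
    ∃[ G ] (Connected G × IsMinimumDegree G δ × IsPowerDominationNumber G 2 ×
    ∃[ r ] (IsPropagationRadius G r ×
    + r ≡ + Graph.order G - + δ - + 2)))
mainTheorem4 = part₁ , part₂
  where
  1≡3k-k-2k+1 : ∀ k → + 1 ≡ k * + 3 - k - + 2 * k + + 1
  1≡3k-k-2k+1 = solve-∀

  1≡[6+m]-[3+m]-2 : ∀ m → + 1 ≡ (+ 6 + m) - (+ 3 + m) - + 2
  1≡[6+m]-[3+m]-2 = solve-∀

  part₁ : ∀ k → 2 ≤ k → ∃[ G ] _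
  part₁ k@(suc k-1) _ = triangles k-1
    , dominatingClique⇒Connected _ (hubClique k-1)
    , triangles-minimumDegree k-1
    , dominatingClique⇒γₚ _ (hubClique k-1) (triangles-lowerBound k-1)
    , 1
    , dominatingClique⇒radₚ≡1 _ (hubClique k-1) (triangles-lowerBound k-1)
    -- The order is a product of naturals, which `pos-*` matches with the integer product in the
    -- identity.
    , trans (1≡3k-k-2k+1 (+ k))
        (cong (λ n → n - + k - + 2 * + k + + 1) (sym (ℤ.pos-* k 3)))

  part₂ : ∀ δ → 3 ≤ δ → ∃[ G ] _
  -- Here `m` is δ - 3, so the order δ + 3 is `6 + m`, and `n ∸ 3` reduces to δ.
  part₂ _ (s≤s (s≤s (s≤s {n = m} _))) = complement split
    , dominatingClique⇒Connected _ (apartClique split)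
    , complement-minimumDegree split
    , dominatingClique⇒γₚ _ (apartClique split) (complement-lowerBound split)
    , 1
    , dominatingClique⇒radₚ≡1 _ (apartClique split) (complement-lowerBound split)
    , 1≡[6+m]-[3+m]-2 (+ m)
    where
    split = twinCycles m
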